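{- Let $n_4,k\in\mathbb{N}$. If $k\ge 2$, then $P_2\square P_2\square P_2\square P_{n_4}$ is equitably $k$-list arborable.
   Context: $P_n$ denotes the path on $n$ vertices and $\square$ the Cartesian product. A $k$-uniform list assignment $L$ for $G$ assigns to each vertex $v$ a set $L(v)$ of exactly $k$ colours; an $L$-colouring is a map $c$ with $c(v)\in L(v)$; it is equitable if every colour class has at most $\lceil |V(G)|/k\rceil$ vertices. $G$ is equitably $k$-list arborable if for every $k$-uniform list assignment $L$ there is an equitable $L$-colouring of $G$ in which every colour class induces an acyclic subgraph. -}

module Defs where

open import Data.Nat using (ℕ; zero; suc; _+_; _≤_; _≟_)
open import Data.Nat.DivMod using (_/_)
open import Data.Fin as Fin using (Fin; toℕ; inject₁; fromℕ)
open import Data.List using (List; []; _∷_; length; filter; allFin; cartesianProduct)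
open import Data.Product using (Σ; ∃; _×_; _,_)
open import Data.Sum using (_⊎_)
open import Relation.Binary.PropositionalEquality using (_≡_)
open import Relation.Nullary using (¬_)
open import Function.Definitions using (Injective)

-- A finite (simple) graph: vertex type, an explicit duplicate-free list of
-- all vertices, and an adjacency relation.
record Graph : Set₁ where
  field
    V     : Set
    verts : List V
    Adj   : V → V → Set
open Graph public

P : ℕ → Graph
P n = record
  { V     = Fin n
  ; verts = allFin n
  ; Adj   = λ i j → (suc (toℕ i) ≡ toℕ j) ⊎ (suc (toℕ j) ≡ toℕ i)
  }

infixr 6 _□_
_□_ : Graph → Graph → Graph
G □ H = record
  { V     = V G × V H
  ; verts = cartesianProduct (verts G) (verts H)
  ; Adj   = λ { (g , h) (g' , h') →
                ((g ≡ g') × Adj H h h') ⊎ (Adj G g g' × (h ≡ h')) }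
  }

-- ⌈ m / k ⌉ for k ≥ 1 (value at k = 0 is irrelevant).
⌈_/_⌉ : ℕ → ℕ → ℕ
⌈ m / zero ⌉  = 0
⌈ m / suc j ⌉ = (m + j) / suc j

-- k-uniform list assignment with colours from ℕ: each vertex gets a set of
-- exactly k colours, given as an injective enumeration Fin k → ℕ.
record UniformListAssignment (G : Graph) (k : ℕ) : Set where
  field
    list      : V G → Fin k → ℕ
    injective : ∀ v → Injective _≡_ _≡_ (list v)
open UniformListAssignment public

IsLColouring : {G : Graph} {k : ℕ} → UniformListAssignment G k → (V G → ℕ) → Set
IsLColouring {G} L c = ∀ (v : V G) → ∃ λ (i : Fin _) → list L v i ≡ c v

colourClassSize : (G : Graph) → (V G → ℕ) → ℕ → ℕ
colourClassSize G c a = length (filter (λ v → c v ≟ a) (verts G))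

IsEquitable : (G : Graph) → ℕ → (V G → ℕ) → Set
IsEquitable G k c = ∀ (a : ℕ) → colourClassSize G c a ≤ ⌈ length (verts G) / k ⌉

record Cycle (G : Graph) : Set where
  field
    m        : ℕ
    m≥2      : 2 ≤ m
    vertex   : Fin (suc m) → V G
    distinct : Injective _≡_ _≡_ vertex
    step     : ∀ (i : Fin m) → Adj G (vertex (inject₁ i)) (vertex (Fin.suc i))
    close    : Adj G (vertex (fromℕ m)) (vertex Fin.zero)
open Cycle public

InducesAcyclic : (G : Graph) → (V G → Set) → Set
InducesAcyclic G Q = ¬ (Σ (Cycle G) λ C → ∀ (i : Fin (suc (m C))) → Q (vertex C i))

EquitablyListArborable : Graph → ℕ → Set
EquitablyListArborable G k =
  ∀ (L : UniformListAssignment G k) →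
    ∃ λ (c : V G → ℕ) →
      IsLColouring L c × IsEquitable G k c ×
      (∀ (a : ℕ) → InducesAcyclic G (λ v → c v ≡ a))

{-# OPTIONS --safe #-}
module Submission where

-- A colouring is certified by a rank and a group of each vertex. If every vertex has at most one
-- neighbour of its own colour and at most its own rank, then a vertex of maximal rank on a
-- monochromatic cycle is contradictory, so the classes are acyclic; if vertices of one group have
-- different colours and there are at most ⌈ N / k ⌉ groups, the colouring is equitable.
--
-- For k ≥ 3, order the vertices layer by layer and colour windows of k consecutive vertices with k
-- distinct colours, the possibly shorter window coming first. A vertex coloured after l others of its
-- window, with f earlier neighbours outside the window, can avoid the l used colours and every colour
-- occurring twice among the f as soon as 2 l + f < 2 k. As f ≤ 4, only the last two vertices of a
-- window matter, and they need f ≤ 1 and f ≤ 3. The order of the cube is such that any four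
-- consecutive vertices contain two like that. For k = 3 this fails for two of the eight residues of
-- the start of the window; there, one vertex of the preceding window is given a suitable colour in
-- advance.
--
-- For k = 2, colour layer by layer, giving different colours to the two ends of each edge of a perfect
-- matching of the cube. On each edge, equality of colours is contained in a bijection between the two
-- lists, so a layer is described by 12 signs, after singling out in each list the colour of the vertex
-- below; that every sign pattern admits a suitable choice is a finite check.
open import Defs
open import Data.Bool using (Bool; true; false; not; _xor_; if_then_else_)
import Data.Bool.Properties as Boolₚ
open import Data.Empty using (⊥)
open import Data.Fin as Fin using (Fin; toℕ; inject₁; fromℕ; fromℕ<; opposite)
open import Data.Fin.Patterns
import Data.Fin.Properties as Finₚ
open import Data.Fin.Relation.Unary.Top using (view; ‵fromℕ; ‵inject₁)
open import Data.List using (List; []; _∷_; _++_; length; filter; lookup; map; allFin; upTo; downFrom; cartesianProduct)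
open import Data.List.Properties
  using (length-++; length-map; length-tabulate; length-filter; length-downFrom; filter-++; filter-accept; filter-reject)
open import Data.List.Membership.Propositional using (_∈_; _∉_; find)
open import Data.List.Membership.Propositional.Properties
import Data.List.Membership.DecPropositional as DecMembership
open import Data.List.Relation.Unary.All as All using (All; []; _∷_)
open import Data.List.Relation.Unary.AllPairs using ([]; _∷_)
open import Data.List.Relation.Unary.Any as Any using (Any; here; there)
open import Data.List.Relation.Unary.Unique.Propositional using (Unique)
import Data.List.Relation.Unary.Unique.Propositional.Properties as Unique
open import Data.Nat
open import Data.Nat.Divisibility using (∣-refl)
open import Data.Nat.DivMod using (_/_; n/n≡1; m*n/n≡m; /-monoˡ-≤; +-distrib-/-∣ˡ)
open import Data.Nat.Induction using (<-rec)
open import Data.Nat.Properties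
open import Data.Product using (∃; ∃₂; _×_; _,_; proj₁; proj₂)
import Data.Product.Properties as Productₚ
open import Data.Sum as Sum using (_⊎_; inj₁; inj₂)
open import Data.Vec as Vec using (Vec; []; _∷_)
open import Data.Vec.Properties using (lookup∘tabulate)
open import Function using (_∘_; Injective; case_of_)
open import Relation.Binary.PropositionalEquality
open import Relation.Nullary
open import Relation.Nullary.Decidable using (from-yes; map′)
open import Relation.Unary using (Decidable)
open import Algebra.Properties.CommutativeSemigroup +-commutativeSemigroup using (interchange)

open DecMembership (Finₚ._≟_ {8}) using () renaming (_∈?_ to _∈₈?_)
open DecMembership _≟_ using (_∈?_)
open import Data.List.Relation.Unary.Unique.DecPropositional _≟_ using (unique?)

-- Acyclicity from ranks

argmax : ∀ {m} (f : Fin (suc m) → ℕ) → ∃ λ i → ∀ j → f j ≤ f i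
argmax {zero}  f = 0F , λ { 0F → ≤-refl }
argmax {suc m} f with argmax (f ∘ Fin.suc)
... | i , max with ≤-total (f 0F) (f (Fin.suc i))
...   | inj₁ f₀≤ = Fin.suc i , λ { 0F → f₀≤ ; (Fin.suc j) → max j }
...   | inj₂ ≤f₀ = 0F , λ { 0F → ≤-refl ; (Fin.suc j) → ≤-trans (max j) ≤f₀ }

Symmetric-Adj : Graph → Set
Symmetric-Adj G = ∀ u v → Adj G u v → Adj G v u

-- The predecessor and the successor along the cycle; `m≥2` gives at least three vertices, which
-- keeps the two distinct.
cycleNeighbours : ∀ {G} → Symmetric-Adj G → (C : Cycle G) (i : Fin (suc (m C))) →
  ∃₂ λ a b → a ≢ b × Adj G (vertex C i) (vertex C a) × Adj G (vertex C i) (vertex C b)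
cycleNeighbours {G} adj-sym record
  { m = suc (suc l) ; m≥2 = s≤s (s≤s _) ; vertex = x ; step = step ; close = close } = go
  where
  go : ∀ i → ∃₂ λ a b → a ≢ b × Adj G (x i) (x a) × Adj G (x i) (x b)
  go 0F = 1F , fromℕ (suc (suc l)) , (λ ()) , step 0F , adj-sym _ _ close
  go (Fin.suc i) with view i
  ... | ‵fromℕ     = inject₁ i , 0F , (λ ()) , adj-sym _ _ (step i) , close
  ... | ‵inject₁ j =
    inject₁ i , Fin.suc (Fin.suc j) , distinct-ends , adj-sym _ _ (step i) , step (Fin.suc j)
    where
    distinct-ends : inject₁ i ≢ Fin.suc (Fin.suc j)
    distinct-ends eq = <⇒≢ (m<n⇒m<1+n (n<1+n _)) (begin-equality
      toℕ j                        ≡⟨ Finₚ.toℕ-inject₁ j ⟨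
      toℕ (inject₁ j)              ≡⟨ Finₚ.toℕ-inject₁ (inject₁ j) ⟨
      toℕ (inject₁ (inject₁ j))    ≡⟨ cong toℕ eq ⟩
      suc (suc (toℕ j))            ∎)
      where open ≤-Reasoning

rankedAcyclic : ∀ {G} {Q : V G → Set} → Symmetric-Adj G → (rank : V G → ℕ) →
  (∀ {v u w} → Q v → Q u → Q w → Adj G v u → Adj G v w →
     rank u ≤ rank v → rank w ≤ rank v → u ≡ w) →
  InducesAcyclic G Q
rankedAcyclic adj-sym rank unique (C , inQ) =
  let i , max = argmax (rank ∘ vertex C)
      a , b , a≢b , adj-a , adj-b = cycleNeighbours adj-sym C i
  in a≢b (distinct C (unique (inQ i) (inQ a) (inQ b) adj-a adj-b (max a) (max b)))

-- Class sizes from groups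

lookup-injective : ∀ {A : Set} {xs : List A} → Unique xs → Injective _≡_ _≡_ (lookup xs)
lookup-injective (px ∷ u) {0F}        {0F}        eq = refl
lookup-injective (px ∷ u) {0F}        {Fin.suc j} eq = contradiction eq (All.lookup px (∈-lookup j))
lookup-injective (px ∷ u) {Fin.suc i} {0F}        eq = contradiction (sym eq) (All.lookup px (∈-lookup i))
lookup-injective (px ∷ u) {Fin.suc i} {Fin.suc j} eq = cong Fin.suc (lookup-injective u eq)

-- Pigeonhole: since `g` is injective on the entries, the positions of `xs` inject into `Fin b`.
length≤ : ∀ {A : Set} {xs : List A} {b} → Unique xs → (g : A → ℕ) →
  (∀ x → g x < b) → (∀ {x y} → x ∈ xs → y ∈ xs → g x ≡ g y → x ≡ y) → length xs ≤ b
length≤ {xs = xs} xs! g g<b g-inj = Finₚ.injective⇒≤ {f = λ i → fromℕ< (g<b (lookup xs i))}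
  λ {i} {j} eq → lookup-injective xs! (g-inj (∈-lookup i) (∈-lookup j) (Finₚ.fromℕ<-injective _ _ _ _ eq))

classSize≤ : ∀ {b} (G : Graph) → Unique (verts G) → (c group : V G → ℕ) → (∀ v → group v < b) →
  (∀ {v w} → c v ≡ c w → group v ≡ group w → v ≡ w) → ∀ a → colourClassSize G c a ≤ b
classSize≤ G verts! c group group<b sep a = length≤ (Unique.filter⁺ (λ v → c v ≟ a) verts!) group group<b
  λ v∈ w∈ → sep (trans (colour v∈) (sym (colour w∈)))
  where
  colour : ∀ {v} → v ∈ filter (λ v → c v ≟ a) (verts G) → c v ≡ a
  colour = proj₂ ∘ ∈-filter⁻ (λ v → c v ≟ a) {xs = verts G}

-- Symmetry, size and coordinates of the grid

P-sym : ∀ n → Symmetric-Adj (P n)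
P-sym n _ _ = Sum.swap

□-sym : ∀ G H → Symmetric-Adj G → Symmetric-Adj H → Symmetric-Adj (G □ H)
□-sym G H G-sym H-sym _ _ (inj₁ (refl , h)) = inj₁ (refl , H-sym _ _ h)
□-sym G H G-sym H-sym _ _ (inj₂ (g , refl)) = inj₂ (G-sym _ _ g , refl)

Grid : ℕ → Graph
Grid n = P 2 □ P 2 □ P 2 □ P n

grid-sym : ∀ n → Symmetric-Adj (Grid n)
grid-sym n = □-sym (P 2) (P 2 □ P 2 □ P n) (P-sym 2)
  (□-sym (P 2) (P 2 □ P n) (P-sym 2) (□-sym (P 2) (P n) (P-sym 2) (P-sym n)))

grid-unique : ∀ n → Unique (verts (Grid n))
grid-unique n = Unique.cartesianProduct⁺ (Unique.allFin⁺ 2) (Unique.cartesianProduct⁺ (Unique.allFin⁺ 2)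
  (Unique.cartesianProduct⁺ (Unique.allFin⁺ 2) (Unique.allFin⁺ n)))

length-cartesianProduct : ∀ {A B : Set} (xs : List A) (ys : List B) →
  length (cartesianProduct xs ys) ≡ length xs * length ys
length-cartesianProduct []       ys = refl
length-cartesianProduct (x ∷ xs) ys = trans (length-++ (map (x ,_) ys))
  (cong₂ _+_ (length-map (x ,_) ys) (length-cartesianProduct xs ys))

grid-size : ∀ n → length (verts (Grid n)) ≡ n * 8
grid-size n = begin
  length (verts (Grid n))
    ≡⟨ length-cartesianProduct (allFin 2) (verts (P 2 □ P 2 □ P n)) ⟩
  2 * length (verts (P 2 □ P 2 □ P n))
    ≡⟨ cong (2 *_) (length-cartesianProduct (allFin 2) (verts (P 2 □ P n))) ⟩
  2 * (2 * length (verts (P 2 □ P n)))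
    ≡⟨ cong (λ l → 2 * (2 * l)) (length-cartesianProduct (allFin 2) (allFin n)) ⟩
  2 * (2 * (2 * length (allFin n)))
    ≡⟨ cong (λ l → 2 * (2 * (2 * l))) (length-tabulate {n = n} (λ i → i)) ⟩
  2 * (2 * (2 * n))
    ≡⟨ trans (cong (2 *_) (sym (*-assoc 2 2 n))) (trans (sym (*-assoc 2 4 n)) (*-comm 8 n)) ⟩
  n * 8 ∎
  where open ≡-Reasoning

-- The numbering of the cube: among any four cyclically consecutive positions, some vertex has no
-- lower neighbour outside these four, and another one has at most two.
position : Fin 2 → Fin 2 → Fin 2 → Fin 8
position 0F 0F 0F = 0F
position 1F 1F 0F = 1F
position 1F 0F 0F = 2F
position 1F 0F 1F = 3F
position 0F 1F 0F = 4F
position 0F 0F 1F = 5F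
position 0F 1F 1F = 6F
position 1F 1F 1F = 7F

unposition : Fin 8 → Fin 2 × Fin 2 × Fin 2
unposition 0F = 0F , 0F , 0F
unposition 1F = 1F , 1F , 0F
unposition 2F = 1F , 0F , 0F
unposition 3F = 1F , 0F , 1F
unposition 4F = 0F , 1F , 0F
unposition 5F = 0F , 0F , 1F
unposition 6F = 0F , 1F , 1F
unposition 7F = 1F , 1F , 1F

unposition-position : ∀ a b c → unposition (position a b c) ≡ (a , b , c)
unposition-position 0F 0F 0F = refl
unposition-position 1F 1F 0F = refl
unposition-position 1F 0F 0F = refl
unposition-position 1F 0F 1F = refl
unposition-position 0F 1F 0F = refl
unposition-position 0F 0F 1F = refl
unposition-position 0F 1F 1F = refl
unposition-position 1F 1F 1F = refl

-- Each neighbour comes with the number of the connecting edge.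
incidences : Fin 8 → List (Fin 12 × Fin 8)
incidences 0F = (0F , 2F) ∷ (3F , 4F) ∷ (5F , 5F) ∷ []
incidences 1F = (1F , 2F) ∷ (4F , 4F) ∷ (9F , 7F) ∷ []
incidences 2F = (0F , 0F) ∷ (1F , 1F) ∷ (2F , 3F) ∷ []
incidences 3F = (2F , 2F) ∷ (6F , 5F) ∷ (Fin.suc 9F , 7F) ∷ []
incidences 4F = (3F , 0F) ∷ (4F , 1F) ∷ (7F , 6F) ∷ []
incidences 5F = (5F , 0F) ∷ (6F , 3F) ∷ (8F , 6F) ∷ []
incidences 6F = (7F , 4F) ∷ (8F , 5F) ∷ (Fin.suc (Fin.suc 9F) , 7F) ∷ []
incidences 7F = (9F , 1F) ∷ (Fin.suc 9F , 3F) ∷ (Fin.suc (Fin.suc 9F) , 6F) ∷ []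

neighbours : Fin 8 → List (Fin 8)
neighbours = map proj₂ ∘ incidences

private
  ∀cube? : {R : Fin 2 → Fin 2 → Fin 2 → Set} → (∀ a b c → Dec (R a b c)) → Dec (∀ a b c → R a b c)
  ∀cube? R? = Finₚ.all? λ a → Finₚ.all? λ b → Finₚ.all? λ c → R? a b c

flip₁-neighbour : ∀ a b c → position (opposite a) b c ∈ neighbours (position a b c)
flip₁-neighbour = from-yes (∀cube? λ a b c → position (opposite a) b c ∈₈? neighbours (position a b c))

flip₂-neighbour : ∀ a b c → position a (opposite b) c ∈ neighbours (position a b c)
flip₂-neighbour = from-yes (∀cube? λ a b c → position a (opposite b) c ∈₈? neighbours (position a b c))

flip₃-neighbour : ∀ a b c → position a b (opposite c) ∈ neighbours (position a b c)
flip₃-neighbour = from-yes (∀cube? λ a b c → position a b (opposite c) ∈₈? neighbours (position a b c))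

P₂-opposite : ∀ {i j} → Adj (P 2) i j → j ≡ opposite i
P₂-opposite {0F} {0F} (inj₁ ())
P₂-opposite {0F} {0F} (inj₂ ())
P₂-opposite {0F} {1F} _ = refl
P₂-opposite {1F} {0F} _ = refl
P₂-opposite {1F} {1F} (inj₁ ())
P₂-opposite {1F} {1F} (inj₂ ())

-- Cells, and transfer of certificates to the grid

Cell : Set
Cell = Fin 8 × ℕ

data Near : Cell → Cell → Set where
  across : ∀ {p q i} → q ∈ neighbours p → Near (p , i) (q , i)
  up     : ∀ {p i} → Near (p , i) (p , suc i)
  down   : ∀ {p i} → Near (p , suc i) (p , i)

module _ {n : ℕ} where
  cell : V (Grid n) → Cell
  cell (a , b , c , i) = position a b c , toℕ i

  cell-injective : ∀ {v w} → cell v ≡ cell w → v ≡ w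
  cell-injective {a , b , c , i} {a′ , b′ , c′ , i′} eq
    with trans (sym (unposition-position a b c))
           (trans (cong unposition (cong proj₁ eq)) (unposition-position a′ b′ c′))
       | Finₚ.toℕ-injective (cong proj₂ eq)
  ... | refl | refl = refl

  near : ∀ {v w} → Adj (Grid n) v w → Near (cell v) (cell w)
  near {a , b , c , i} (inj₂ (e , refl)) rewrite P₂-opposite e = across (flip₁-neighbour a b c)
  near {a , b , c , i} (inj₁ (refl , inj₂ (e , refl))) rewrite P₂-opposite e = across (flip₂-neighbour a b c)
  near {a , b , c , i} (inj₁ (refl , inj₁ (refl , inj₂ (e , refl)))) rewrite P₂-opposite e =
    across (flip₃-neighbour a b c)
  near (inj₁ (refl , inj₁ (refl , inj₁ (refl , inj₁ e)))) rewrite sym e = up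
  near (inj₁ (refl , inj₁ (refl , inj₁ (refl , inj₂ e)))) rewrite sym e = down

-- The certificate by ranks and groups. Cells have unbounded layers, so the conditions are
-- restricted to the layers below `n`.
record Solution (n k : ℕ) (list : Cell → Fin k → ℕ) : Set where
  field
    colour rank group : Cell → ℕ
    valid  : ∀ p {i} → i < n → ∃ λ s → list (p , i) s ≡ colour (p , i)
    bound  : ∀ p {i} → i < n → group (p , i) < ⌈ n * 8 / k ⌉
    sep    : ∀ {p q i j} → i < n → j < n →
             colour (p , i) ≡ colour (q , j) → group (p , i) ≡ group (q , j) → (p , i) ≡ (q , j)
    forest : ∀ {x y z} → proj₂ x < n → proj₂ y < n → proj₂ z < n → Near x y → Near x z →
             colour y ≡ colour x → colour z ≡ colour x → rank y ≤ rank x → rank z ≤ rank x → y ≡ z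

-- Makes the lists of a finite column total on all layers, so that colourings can be built without
-- bounds.
extend : ∀ {A : Set} {n} → A → (Fin n → A) → ℕ → A
extend {n = zero}  a f i       = a
extend {n = suc n} a f zero    = f 0F
extend {n = suc n} a f (suc i) = extend a (f ∘ Fin.suc) i

extend-toℕ : ∀ {A : Set} {n} (a : A) (f : Fin n → A) i → extend a f (toℕ i) ≡ f i
extend-toℕ a f 0F          = refl
extend-toℕ a f (Fin.suc i) = extend-toℕ a (f ∘ Fin.suc) i

extend-preserves : ∀ {A : Set} (R : A → Set) {n a} {f : Fin n → A} → R a → (∀ i → R (f i)) → ∀ i → R (extend a f i)
extend-preserves R {zero}  ra rf i       = ra
extend-preserves R {suc n} ra rf zero    = rf 0F
extend-preserves R {suc n} ra rf (suc i) = extend-preserves R ra (rf ∘ Fin.suc) i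

arborable : ∀ n k → ((list : Cell → Fin k → ℕ) → (∀ x → Injective _≡_ _≡_ (list x)) → Solution n k list) →
  EquitablyListArborable (Grid n) k
arborable n k solve L = c , valid′ , equitable , acyclic
  where
  column : Fin 2 × Fin 2 × Fin 2 → Fin n → Fin k → ℕ
  column (a , b , c) i = list L (a , b , c , i)

  lists : Cell → Fin k → ℕ
  -- Above the grid the list is 0, ..., k - 1, given by `toℕ`, which keeps every list injective.
  lists (p , i) = extend toℕ (column (unposition p)) i

  lists-injective : ∀ x → Injective _≡_ _≡_ (lists x)
  lists-injective (p , i) = extend-preserves (Injective _≡_ _≡_) Finₚ.toℕ-injective
    (λ j → injective L (_ , _ , _ , j)) i

  lists-cell : ∀ v → lists (cell v) ≡ list L v
  lists-cell (a , b , c , i) rewrite unposition-position a b c = extend-toℕ toℕ (column (a , b , c)) i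

  open Solution (solve lists lists-injective)

  layer<n : (v : V (Grid n)) → proj₂ (cell v) < n
  layer<n (a , b , c , i) = Finₚ.toℕ<n i

  c : V (Grid n) → ℕ
  c v = colour (cell v)

  valid′ : IsLColouring L c
  valid′ v with valid (proj₁ (cell v)) (layer<n v)
  ... | s , eq rewrite lists-cell v = s , eq

  equitable : IsEquitable (Grid n) k c
  equitable rewrite grid-size n = classSize≤ (Grid n) (grid-unique n) c (group ∘ cell)
    (λ v → bound _ (layer<n v))
    (λ {v} {w} same same′ → cell-injective (sep (layer<n v) (layer<n w) same same′))

  acyclic : ∀ a → InducesAcyclic (Grid n) (λ v → c v ≡ a)
  acyclic a = rankedAcyclic (grid-sym n) (rank ∘ cell) λ {v} {u} {w} cv cu cw v~u v~w ru rw →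
    cell-injective (forest (layer<n v) (layer<n u) (layer<n w) (near v~u) (near v~w)
      (trans cu (sym cv)) (trans cw (sym cv)) ru rw)

-- Two colours

∀bits? : ∀ {n} {R : Vec Bool n → Set} → (∀ v → Dec (R v)) → Dec (∀ v → R v)
∀bits? {zero}  R? = map′ (λ { r [] → r }) (λ f → f []) (R? [])
∀bits? {suc n} R? = map′ (λ { (f , t) (false ∷ v) → f v ; (f , t) (true ∷ v) → t v })
  (λ r → (λ v → r (false ∷ v)) , (λ v → r (true ∷ v)))
  (∀bits? (R? ∘ (false ∷_)) ×-dec ∀bits? (R? ∘ (true ∷_)))

∃bits? : ∀ {n} {R : Vec Bool n → Set} → (∀ v → Dec (R v)) → Dec (∃ R)
∃bits? {zero}  R? = map′ ([] ,_) (λ { ([] , r) → r }) (R? [])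
∃bits? {suc n} R? = map′
  (λ { (inj₁ (v , r)) → false ∷ v , r ; (inj₂ (v , r)) → true ∷ v , r })
  (λ { (false ∷ v , r) → inj₁ (v , r) ; (true ∷ v , r) → inj₂ (v , r) })
  (∃bits? (R? ∘ (false ∷_)) ⊎-dec ∃bits? (R? ∘ (true ∷_)))

∈-≤1 : ∀ {A : Set} {xs : List A} {x y} → length xs ≤ 1 → x ∈ xs → y ∈ xs → x ≡ y
∈-≤1 {xs = _ ∷ []} _ (here refl) (here refl) = refl
∈-≤1 {xs = _ ∷ _ ∷ _} (s≤s ())

quotient-unique : ∀ {d a b} i j → a < d → b < d → i * d + a ≡ j * d + b → i ≡ j × a ≡ b
quotient-unique zero zero _ _ eq = refl , eq
quotient-unique {d} {a} {b} zero (suc j) a<d _ eq =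
  contradiction (subst (d ≤_) (sym eq) (≤-trans (m≤m+n d (j * d)) (m≤m+n _ b))) (<⇒≱ a<d)
quotient-unique {d} {a} {b} (suc i) zero _ b<d eq =
  contradiction (subst (d ≤_) eq (≤-trans (m≤m+n d (i * d)) (m≤m+n _ a))) (<⇒≱ b<d)
quotient-unique {d} {a} {b} (suc i) (suc j) a<d b<d eq =
  let i≡j , a≡b = quotient-unique i j a<d b<d
        (+-cancelˡ-≡ d _ _ (trans (sym (+-assoc d (i * d) a)) (trans eq (+-assoc d (j * d) b))))
  in cong suc i≡j , a≡b

quotient-< : ∀ {d a i n} → a < d → i < n → i * d + a < n * d
quotient-< {d} {a} {i} {n} a<d i<n = begin-strict
  i * d + a   <⟨ +-monoʳ-< (i * d) a<d ⟩
  i * d + d   ≡⟨ +-comm (i * d) d ⟩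
  suc i * d   ≤⟨ *-monoˡ-≤ d i<n ⟩
  n * d       ∎
  where open ≤-Reasoning

-- Edge signs of the cube and the finite check

ends : Fin 12 → Fin 8 × Fin 8
ends 0F = 0F , 2F
ends 1F = 1F , 2F
ends 2F = 2F , 3F
ends 3F = 0F , 4F
ends 4F = 1F , 4F
ends 5F = 0F , 5F
ends 6F = 3F , 5F
ends 7F = 4F , 6F
ends 8F = 5F , 6F
ends 9F = 1F , 7F
ends (Fin.suc 9F) = 3F , 7F
ends (Fin.suc (Fin.suc 9F)) = 6F , 7F

Ends : Fin 8 → Fin 12 × Fin 8 → Set
Ends p (e , q) = ends e ≡ (p , q) ⊎ ends e ≡ (q , p)

incidences-ends : ∀ p → All (Ends p) (incidences p)
incidences-ends = from-yes (Finₚ.all? λ p →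
  All.all? (λ (e , q) → (ends e ≟₂ (p , q)) ⊎-dec (ends e ≟₂ (q , p))) (incidences p))
  where
  _≟₂_ = Productₚ.≡-dec (Finₚ._≟_ {8}) (Finₚ._≟_ {8})

-- The perfect matching {0,2}, {1,4}, {5,6}, {3,7} of the cube. Matchings by
-- parallel edges do not admit all sign patterns.
pair : Fin 8 → ℕ
pair 0F = 0
pair 1F = 1
pair 2F = 0
pair 3F = 3
pair 4F = 1
pair 5F = 2
pair 6F = 2
pair 7F = 3

pair<4 : ∀ p → pair p < 4
pair<4 = from-yes (Finₚ.all? λ p → pair p <? 4)

paired : ∀ p q → pair p ≡ pair q → p ≡ q ⊎ q ∈ neighbours p
paired = from-yes (Finₚ.all? λ p → Finₚ.all? λ q →
  (pair p ≟ pair q) →-dec ((p Finₚ.≟ q) ⊎-dec (q ∈₈? neighbours p)))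

-- Found by computer search: this order and its reverse together suffice for all sign patterns.
place : Fin 8 → ℕ
place 0F = 6
place 1F = 7
place 2F = 2
place 3F = 0
place 4F = 4
place 5F = 5
place 6F = 1
place 7F = 3

orderedPlace : Bool → Fin 8 → ℕ
orderedPlace o p = if o then place p else 7 ∸ place p

orderedPlace<8 : ∀ o p → orderedPlace o p < 8
orderedPlace<8 false = from-yes (Finₚ.all? λ p → orderedPlace false p <? 8)
orderedPlace<8 true  = from-yes (Finₚ.all? λ p → orderedPlace true p <? 8)

-- Places lie below 8, so all vertices marked true rank above all those marked false.
layerRank : Vec Bool 8 → Bool → Fin 8 → ℕ
layerRank t o p = if Vec.lookup t p then 8 + orderedPlace o p else orderedPlace o p

layerRank<16 : ∀ t o p → layerRank t o p < 16
layerRank<16 t o p with Vec.lookup t p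
... | true  = +-monoʳ-< 8 (orderedPlace<8 o p)
... | false = <-≤-trans (orderedPlace<8 o p) (m≤m+n 8 8)

module _ (σ : Vec Bool 12) (t : Vec Bool 8) where
  -- `σ` holds the edge signs, `t` the choice at each vertex from its two colours. Only an edge that
  -- matches can be monochromatic.
  Match : Fin 8 → Fin 12 × Fin 8 → Set
  Match p (e , q) = Vec.lookup t p xor Vec.lookup t q ≡ Vec.lookup σ e

  match? : ∀ p x → Dec (Match p x)
  match? p (e , q) = (Vec.lookup t p xor Vec.lookup t q) Boolₚ.≟ Vec.lookup σ e

  module _ (o : Bool) where
    Lower : Fin 8 → Fin 12 × Fin 8 → Set
    Lower p (e , q) = Match p (e , q) × layerRank t o q ≤ layerRank t o p

    lower? : ∀ p x → Dec (Lower p x)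
    lower? p (e , q) = match? p (e , q) ×-dec (layerRank t o q ≤? layerRank t o p)

    -- A vertex marked false may repeat the colour below it, hence must have no earlier neighbour
    -- of its colour in its own layer.
    Good : Set
    Good = (∀ p → length (filter (lower? p) (incidences p)) ≤ (if Vec.lookup t p then 1 else 0))
         × (∀ p → All (λ x → Match p x → pair p ≢ pair (proj₂ x)) (incidences p))

    good? : Dec Good
    good? = (Finₚ.all? λ p → length (filter (lower? p) (incidences p)) ≤? (if Vec.lookup t p then 1 else 0))
      ×-dec (Finₚ.all? λ p → All.all? (λ x → match? p x →-dec ¬? (pair p ≟ pair (proj₂ x))) (incidences p))

-- The first four bits choose one end of each matching edge, the last one the order.
transversal : Vec Bool 12 → Vec Bool 5 → Vec Bool 8
transversal σ (a ∷ b ∷ c ∷ d ∷ _) =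
  a ∷ b ∷ other 0F a ∷ d ∷ other 4F b ∷ c ∷ other 8F c ∷ other (Fin.suc 9F) d ∷ []
  where
  -- The xor across the matching edge becomes the negation of its sign, so its ends never match.
  other : Fin 12 → Bool → Bool
  other e x = not (x xor Vec.lookup σ e)

abstract
  -- Exhaustive check of the 4096 sign patterns, with 32 candidates for each.
  goodTransversal : ∀ σ → ∃ λ s → Good σ (transversal σ s) (Vec.last s)
  goodTransversal = from-yes (∀bits? λ σ → ∃bits? λ s → good? σ (transversal σ s) (Vec.last s))

-- true stands for a colour differing from the colour of the vertex below.
orient : ∀ {l : Fin 2 → ℕ} → Injective _≡_ _≡_ l → ∀ b →
  ∃ λ (f : Bool → Fin 2) → l (f false) ≢ l (f true) × l (f true) ≢ b
orient {l} l-inj b with l 1F ≟ b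
... | yes l₁≡b = (λ x → if x then 0F else 1F) ,
  (λ eq → case l-inj eq of λ ()) , λ l₀≡b → case l-inj (trans l₀≡b (sym l₁≡b)) of λ ()
... | no  l₁≢b = (λ x → if x then 1F else 0F) , (λ eq → case l-inj eq of λ ()) , l₁≢b

-- Signs from lists, and the colouring of one layer

crossed : ∀ {A B : Set} → Dec A → Dec B → Bool
crossed (no _) (no _) = true
crossed _      _      = false

-- Equality of colours is contained in a bijection between the two lists: the straight one (false)
-- if some straight equality holds, otherwise the crossed one (true).
sign : (f g : Bool → ℕ) → Bool
sign f g = crossed (f false ≟ g false) (f true ≟ g true)

-- Each list has distinct colours, so one straight equality excludes both crossed ones.
sign-correct : ∀ (f g : Bool → ℕ) → f false ≢ f true → g false ≢ g true →
  ∀ x y → f x ≡ g y → x xor y ≡ sign f g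
sign-correct f g f≢ g≢ = go (f false ≟ g false) (f true ≟ g true)
  where
  go : (d : Dec (f false ≡ g false)) (d′ : Dec (f true ≡ g true)) → ∀ x y → f x ≡ g y → x xor y ≡ crossed d d′
  go (yes _) _       false false eq = refl
  go (yes e) _       false true  eq = contradiction (trans (sym e) eq) g≢
  go (yes e) _       true  false eq = contradiction (trans e (sym eq)) f≢
  go (yes _) _       true  true  eq = refl
  go (no _)  (yes _) false false eq = refl
  go (no _)  (yes e) false true  eq = contradiction (trans eq (sym e)) f≢
  go (no _)  (yes e) true  false eq = contradiction (trans (sym eq) e) g≢
  go (no _)  (yes _) true  true  eq = refl
  go (no ¬e) (no _)  false false eq = contradiction eq ¬e
  go (no _)  (no _)  false true  eq = refl
  go (no _)  (no _)  true  false eq = refl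
  go (no _)  (no ¬e) true  true  eq = contradiction eq ¬e

-- By `side` and `back` together, a vertex has at most one neighbour of its colour among the vertex
-- below and those of no higher rank in its layer.
record LayerColouring (list : Fin 8 → Fin 2 → ℕ) (below : Fin 8 → ℕ) : Set where
  field
    colour rank : Fin 8 → ℕ
    valid   : ∀ p → ∃ λ s → list p s ≡ colour p
    rank<16 : ∀ p → rank p < 16
    sep     : ∀ {p q} → colour p ≡ colour q → pair p ≡ pair q → p ≡ q
    side    : ∀ {p q r} → q ∈ neighbours p → r ∈ neighbours p → colour q ≡ colour p → colour r ≡ colour p →
              rank q ≤ rank p → rank r ≤ rank p → q ≡ r
    back    : ∀ {p q} → q ∈ neighbours p → colour p ≡ below p → colour q ≡ colour p → ¬ rank q ≤ rank p

module _ (list : Fin 8 → Fin 2 → ℕ) (below : Fin 8 → ℕ)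
  (oriented : ∀ p → ∃ λ (f : Bool → Fin 2) → list p (f false) ≢ list p (f true) × list p (f true) ≢ below p)
  where
  private
    value : Fin 8 → Bool → ℕ
    value p = list p ∘ proj₁ (oriented p)

    value≢ : ∀ p → value p false ≢ value p true
    value≢ p = proj₁ (proj₂ (oriented p))

    fresh : ∀ p → value p true ≢ below p
    fresh p = proj₂ (proj₂ (oriented p))

  endSign : Fin 8 × Fin 8 → Bool
  endSign (p , q) = sign (value p) (value q)

  module _ {σ : Vec Bool 12} (σ-sign : ∀ e → Vec.lookup σ e ≡ endSign (ends e))
    {t : Vec Bool 8} {o : Bool} (good : Good σ t o) where
    private
      colour : Fin 8 → ℕ
      colour p = value p (Vec.lookup t p)

      match : ∀ {p e q} → (e , q) ∈ incidences p → colour q ≡ colour p → Match σ t p (e , q)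
      match {p} {e} {q} eq∈ same = trans (aux (All.lookup (incidences-ends p) eq∈)) (sym (σ-sign e))
        where
        aux : Ends p (e , q) → Vec.lookup t p xor Vec.lookup t q ≡ endSign (ends e)
        aux (inj₁ eq) = trans (sign-correct (value p) (value q) (value≢ p) (value≢ q) (Vec.lookup t p) (Vec.lookup t q) (sym same))
          (cong endSign (sym eq))
        aux (inj₂ eq) = trans (Boolₚ.xor-comm (Vec.lookup t p) _)
          (trans (sign-correct (value q) (value p) (value≢ q) (value≢ p) (Vec.lookup t q) (Vec.lookup t p) same)
            (cong endSign (sym eq)))

      conflict : ∀ {p q} → q ∈ neighbours p → colour q ≡ colour p → layerRank t o q ≤ layerRank t o p →
        ∃ λ e → (e , q) ∈ filter (lower? σ t o p) (incidences p)
      conflict {p} q∈ same q≤p with ∈-map⁻ proj₂ q∈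
      ... | (e , q) , eq∈ , refl = e , ∈-filter⁺ (lower? σ t o p) eq∈ (match eq∈ same , q≤p)

      sep : ∀ {p q} → colour p ≡ colour q → pair p ≡ pair q → p ≡ q
      sep {p} {q} same together with paired p q together
      ... | inj₁ p≡q = p≡q
      ... | inj₂ q∈ with ∈-map⁻ proj₂ q∈
      ...   | _ , eq∈ , refl = contradiction together (All.lookup (proj₂ good p) eq∈ (match eq∈ (sym same)))

      allowance : ∀ b → (if b then 1 else 0) ≤ 1
      allowance true  = ≤-refl
      allowance false = z≤n

      side : ∀ {p q r} → q ∈ neighbours p → r ∈ neighbours p → colour q ≡ colour p → colour r ≡ colour p →
        layerRank t o q ≤ layerRank t o p → layerRank t o r ≤ layerRank t o p → q ≡ r
      side {p} q∈ r∈ cq cr q≤p r≤p = cong proj₂ (∈-≤1 (≤-trans (proj₁ good p) (allowance (Vec.lookup t p)))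
        (proj₂ (conflict q∈ cq q≤p)) (proj₂ (conflict r∈ cr r≤p)))

      -- A vertex marked true differs from the colour below; one marked false has allowance 0, so no
      -- conflicting neighbour.
      back : ∀ {p q} → q ∈ neighbours p → colour p ≡ below p → colour q ≡ colour p →
        ¬ layerRank t o q ≤ layerRank t o p
      back {p} q∈ old same q≤p = go (Vec.lookup t p) refl
        where
        go : ∀ b → Vec.lookup t p ≡ b → ⊥
        go true  eq = fresh p (trans (cong (value p) (sym eq)) old)
        go false eq = <⇒≱ (∈-length (proj₂ (conflict q∈ same q≤p)))
          (subst (λ b → length (filter (lower? σ t o p) (incidences p)) ≤ (if b then 1 else 0)) eq (proj₁ good p))

    layerColouring : LayerColouring list below
    layerColouring = record
      { colour  = colour
      ; rank    = layerRank t o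
      ; valid   = λ p → _ , refl
      ; rank<16 = layerRank<16 t o
      ; sep     = sep
      ; side    = side
      ; back    = back
      }

abstract
  colourLayer : ∀ list → (∀ p → Injective _≡_ _≡_ (list p)) → ∀ below → LayerColouring list below
  colourLayer list list-inj below =
    let s , good = goodTransversal σ
    in layerColouring list below oriented {σ} (lookup∘tabulate (endSign list below oriented ∘ ends))
      {transversal σ s} {Vec.last s} good
    where
    oriented : ∀ p → ∃ λ (f : Bool → Fin 2) → list p (f false) ≢ list p (f true) × list p (f true) ≢ below p
    oriented p = orient (list-inj p) (below p)

    σ : Vec Bool 12
    σ = Vec.tabulate (endSign list below oriented ∘ ends)

-- Stacking the layers

module _ (list : Cell → Fin 2 → ℕ) (list-inj : ∀ x → Injective _≡_ _≡_ (list x)) where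
  mutual
    below : ℕ → Fin 8 → ℕ
    -- Nothing lies below the bottom layer; the default colour is arbitrary.
    below zero    _ = 0
    below (suc i)   = LayerColouring.colour (layer i)

    layer : ∀ i → LayerColouring (λ p → list (p , i)) (below i)
    layer i = colourLayer (λ p → list (p , i)) (λ p → list-inj (p , i)) (below i)

  private
    colour rank group : Cell → ℕ
    colour (p , i) = LayerColouring.colour (layer i) p
    -- Ranks within a layer are below 16, so each layer outranks all lower ones.
    rank   (p , i) = i * 16 + LayerColouring.rank (layer i) p
    group  (p , i) = i * 4 + pair p

    same-layer : ∀ i {p q} → rank (q , i) ≤ rank (p , i) →
      LayerColouring.rank (layer i) q ≤ LayerColouring.rank (layer i) p
    same-layer i = +-cancelˡ-≤ (i * 16) _ _

    up-rank : ∀ i {p q} → ¬ rank (q , suc i) ≤ rank (p , i)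
    up-rank i {p} {q} = <⇒≱ (<-≤-trans (quotient-< (LayerColouring.rank<16 (layer i) p) (n<1+n i)) (m≤m+n _ _))

    forest : ∀ {x y z} → Near x y → Near x z →
      colour y ≡ colour x → colour z ≡ colour x → rank y ≤ rank x → rank z ≤ rank x → y ≡ z
    forest {p , i} (across {q = q} q∈) (across {q = r} r∈) cq cr q≤ r≤ =
      cong (_, i) (LayerColouring.side (layer i) q∈ r∈ cq cr (same-layer i {p} {q} q≤) (same-layer i {p} {r} r≤))
    forest {p , suc i} (across {q = q} q∈) down cq cr q≤ r≤ =
      contradiction (same-layer (suc i) {p} {q} q≤) (LayerColouring.back (layer (suc i)) q∈ (sym cr) cq)
    forest {p , suc i} down (across {q = r} r∈) cq cr q≤ r≤ =
      contradiction (same-layer (suc i) {p} {r} r≤) (LayerColouring.back (layer (suc i)) r∈ (sym cq) cr)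
    forest down down _ _ _ _ = refl
    forest {p , i} up _ _ _ q≤ _ = contradiction q≤ (up-rank i {p} {p})
    forest {p , i} _ up _ _ _ r≤ = contradiction r≤ (up-rank i {p} {p})

    -- Four matching edges per layer use up exactly the number of groups allowed.
    groups≤ : ∀ n → n * 4 ≤ ⌈ n * 8 / 2 ⌉
    groups≤ n = begin
      n * 4             ≡⟨ m*n/n≡m (n * 4) 2 ⟨
      n * 4 * 2 / 2     ≡⟨ cong (_/ 2) (*-assoc n 4 2) ⟩
      n * 8 / 2         ≤⟨ /-monoˡ-≤ 2 (m≤m+n (n * 8) 1) ⟩
      (n * 8 + 1) / 2   ∎
      where open ≤-Reasoning

  solution₂ : ∀ n → Solution n 2 list
  solution₂ n = record
    { colour = colour
    ; rank   = rank
    ; group  = group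
    ; valid  = λ p {i} _ → LayerColouring.valid (layer i) p
    ; bound  = λ p i<n → <-≤-trans (quotient-< (pair<4 p) i<n) (groups≤ n)
    ; sep    = sep
    ; forest = λ _ _ _ → forest
    }
    where
    sep : ∀ {p q i j} → i < n → j < n →
      colour (p , i) ≡ colour (q , j) → group (p , i) ≡ group (q , j) → (p , i) ≡ (q , j)
    sep {p} {q} {i} {j} _ _ same together with quotient-unique i j (pair<4 p) (pair<4 q) together
    ... | refl , pp = cong (_, i) (LayerColouring.sep (layer i) same pp)

-- Three or more colours

count : ℕ → List ℕ → ℕ
count a = length ∘ filter (_≟ a)

count-++ : ∀ a xs ys → count a (xs ++ ys) ≡ count a xs + count a ys
count-++ a xs ys = trans (cong length (filter-++ (_≟ a) xs ys)) (length-++ (filter (_≟ a) xs))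

∈⇒0<count : ∀ {a xs} → a ∈ xs → 0 < count a xs
∈⇒0<count {a} a∈ = ∈-length (∈-filter⁺ (_≟ a) a∈ refl)

module _ {A : Set} {P : A → Set} (P? : Decidable P) where
  length-filter-map : ∀ {B : Set} (f : B → A) xs → length (filter P? (map f xs)) ≡ length (filter (P? ∘ f) xs)
  length-filter-map f [] = refl
  length-filter-map f (x ∷ xs) with does (P? (f x))
  ... | true  = cong suc (length-filter-map f xs)
  ... | false = length-filter-map f xs

  length-filter-split : ∀ xs → length (filter P? xs) + length (filter (¬? ∘ P?) xs) ≡ length xs
  length-filter-split [] = refl
  length-filter-split (x ∷ xs) with does (P? x)
  ... | true  = cong suc (length-filter-split xs)
  ... | false = trans (+-suc _ _) (cong suc (length-filter-split xs))

  filter-filter : ∀ {Q : A → Set} (Q? : Decidable Q) → (∀ {x} → P x → Q x) → ∀ xs →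
    filter P? (filter Q? xs) ≡ filter P? xs
  filter-filter Q? P⇒Q [] = refl
  filter-filter Q? P⇒Q (x ∷ xs) with P? x
  ... | yes p = trans (cong (filter P?) (filter-accept Q? (P⇒Q p)))
                  (trans (filter-accept P? p) (cong (x ∷_) (filter-filter Q? P⇒Q xs)))
  ... | no ¬p with does (Q? x)
  ...   | true  = trans (filter-reject P? ¬p) (filter-filter Q? P⇒Q xs)
  ...   | false = filter-filter Q? P⇒Q xs

without : ℕ → List ℕ → List ℕ
without a = filter (¬? ∘ (_≟ a))

-- If the first colour occurs at least twice, deleting its occurrences shortens `X` by two or more
-- and leaves the counts of the other colours unchanged; induct on the number of colours.
rareColour : ∀ k {f : Fin k → ℕ} → Injective _≡_ _≡_ f → ∀ X → length X < k + k → ∃ λ i → count (f i) X ≤ 1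
rareColour (suc k) {f} f-inj X X< with count (f 0F) X ≤? 1
... | yes rare = 0F , rare
... | no ¬rare =
  let i , rare = rareColour k {f ∘ Fin.suc} (λ eq → Finₚ.suc-injective (f-inj eq)) (without (f 0F) X) shorter
  in Fin.suc i , subst (_≤ 1) (cong length (filter-filter (_≟ f (Fin.suc i)) (¬? ∘ (_≟ f 0F))
       (λ x≡ x≡′ → case f-inj (trans (sym x≡) x≡′) of λ ()) X)) rare
  where
  shorter : length (without (f 0F) X) < k + k
  shorter = +-cancelˡ-< 2 _ _ (begin-strict
    2 + length (without (f 0F) X)               ≤⟨ +-monoˡ-≤ _ (≰⇒> ¬rare) ⟩
    count (f 0F) X + length (without (f 0F) X)  ≡⟨ length-filter-split (_≟ f 0F) X ⟩
    length X                                    <⟨ X< ⟩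
    suc k + suc k                               ≡⟨ cong suc (+-suc k k) ⟩
    2 + (k + k)                                 ∎)
    where open ≤-Reasoning

-- Greedy colouring of a window

module _ {k : ℕ} (list : ℕ → Fin k → ℕ) (list-inj : ∀ j → Injective _≡_ _≡_ (list j)) where

  -- Doubling the used colours makes "at most one occurrence" forbid them altogether.
  newColour : ∀ v used F → length used + length used + length F < k + k →
    ∃ λ s → list v s ∉ used × count (list v s) F ≤ 1
  newColour v used F small =
    let s , rare = rareColour k (list-inj v) (used ++ (used ++ F)) (subst (_< k + k) (sym total) small)
        split = subst (_≤ 1) (trans (count-++ (list v s) used (used ++ F))
          (cong (count (list v s) used +_) (count-++ (list v s) used F))) rare
    in s
     , (λ s∈ → contradiction (≤-trans (+-mono-≤ (∈⇒0<count s∈) (≤-trans (∈⇒0<count s∈) (m≤m+n _ _))) split)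
         λ { (s≤s ()) })
     , ≤-trans (≤-trans (m≤n+m _ (count (list v s) used)) (m≤n+m _ (count (list v s) used))) split
    where
    total : length (used ++ (used ++ F)) ≡ length used + length used + length F
    total = trans (length-++ used) (trans (cong (length used +_) (length-++ used)) (sym (+-assoc (length used) _ _)))

  module _ (m : ℕ) (F : ℕ → List ℕ) where
    -- The head is coloured last, after the `length ps` others; the condition is `2 l + f < 2 k`.
    data Weighted : List ℕ → Set where
      []  : Weighted []
      _∷_ : ∀ {p ps} → length ps + length ps + length (F p) < k + k → Weighted ps → Weighted (p ∷ ps)

    record Extension (ps : List ℕ) (c : ℕ → ℕ) : Set where
      field
        colour  : ℕ → ℕ
        old     : ∀ j → (∀ {p} → p ∈ ps → j ≢ m + p) → colour j ≡ c j
        valid   : ∀ {p} → p ∈ ps → ∃ λ s → list (m + p) s ≡ colour (m + p)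
        rare    : ∀ {p} → p ∈ ps → count (colour (m + p)) (F p) ≤ 1
        rainbow : ∀ {p q} → p ∈ ps → q ∈ ps → colour (m + p) ≡ colour (m + q) → p ≡ q

    -- The tail is coloured first; the weight of the head is then what `newColour` needs when the
    -- colours of the tail are the used ones.
    extendColouring : ∀ {ps} → Unique ps → Weighted ps → ∀ c → Extension ps c
    extendColouring {[]} _ _ c = record
      { colour = c ; old = λ _ _ → refl ; valid = λ () ; rare = λ () ; rainbow = λ () }
    extendColouring {p ∷ ps} (p∉ ∷ ps!) (p-weight ∷ weights) c = record
      { colour  = colour′
      ; old     = λ j j∉ → trans (elsewhere (j∉ (here refl))) (old j (j∉ ∘ there))
      ; valid   = λ { (here refl) → s , sym at-p
                    ; (there q∈) → proj₁ (valid q∈) , trans (proj₂ (valid q∈)) (sym (on-ps q∈)) }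
      ; rare    = λ { (here refl) → subst (λ a → count a (F p) ≤ 1) (sym at-p) s-rare
                    ; {q} (there q∈) → subst (λ a → count a (F q) ≤ 1) (sym (on-ps q∈)) (rare q∈) }
      ; rainbow = λ { (here refl) (here refl) eq → refl
                    ; (here refl) (there q∈) eq → contradiction (trans (sym at-p) (trans eq (on-ps q∈))) (s-new q∈)
                    ; (there q∈) (here refl) eq → contradiction (trans (sym at-p) (trans (sym eq) (on-ps q∈))) (s-new q∈)
                    ; (there q∈) (there r∈) eq → rainbow q∈ r∈ (trans (sym (on-ps q∈)) (trans eq (on-ps r∈))) }
      }
      where
      open Extension (extendColouring ps! weights c)

      used : List ℕ
      used = map (colour ∘ (m +_)) ps

      new : ∃ λ s → list (m + p) s ∉ used × count (list (m + p) s) (F p) ≤ 1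
      new = newColour (m + p) used (F p)
        (subst (λ l → l + l + length (F p) < k + k) (sym (length-map (colour ∘ (m +_)) ps)) p-weight)

      s : Fin k
      s = proj₁ new

      s-rare : count (list (m + p) s) (F p) ≤ 1
      s-rare = proj₂ (proj₂ new)

      s-new : ∀ {q} → q ∈ ps → list (m + p) s ≢ colour (m + q)
      s-new q∈ eq = proj₁ (proj₂ new) (subst (_∈ used) (sym eq) (∈-map⁺ (colour ∘ (m +_)) q∈))

      colour′ : ℕ → ℕ
      colour′ j with j ≟ m + p
      ... | yes _ = list (m + p) s
      ... | no _  = colour j

      at-p : colour′ (m + p) ≡ list (m + p) s
      at-p with m + p ≟ m + p
      ... | yes _ = refl
      ... | no ¬e = contradiction refl ¬e

      elsewhere : ∀ {j} → j ≢ m + p → colour′ j ≡ colour j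
      elsewhere {j} j≢ with j ≟ m + p
      ... | yes e = contradiction e j≢
      ... | no _  = refl

      on-ps : ∀ {q} → q ∈ ps → colour′ (m + q) ≡ colour (m + q)
      on-ps q∈ = elsewhere λ eq → All.lookup p∉ q∈ (sym (+-cancelˡ-≡ m _ _ eq))

-- The vertex at position p of layer i has index i * 8 + p; its neighbours of smaller index
-- lie at these distances, 8 being the distance between layers.
offsets : ℕ → List ℕ
offsets 0 = 8 ∷ []
offsets 1 = 8 ∷ []
offsets 2 = 2 ∷ 1 ∷ 8 ∷ []
offsets 3 = 1 ∷ 8 ∷ []
offsets 4 = 4 ∷ 3 ∷ 8 ∷ []
offsets 5 = 5 ∷ 2 ∷ 8 ∷ []
offsets 6 = 2 ∷ 1 ∷ 8 ∷ []
offsets 7 = 6 ∷ 4 ∷ 1 ∷ 8 ∷ []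
offsets (suc (suc (suc (suc (suc (suc (suc (suc j)))))))) = offsets j

periodic : ∀ {R : ℕ → Set} → (∀ j → R j → R (8 + j)) → (∀ (p : Fin 8) → R (toℕ p)) → ∀ j → R j
periodic step base 0 = base 0F
periodic step base 1 = base 1F
periodic step base 2 = base 2F
periodic step base 3 = base 3F
periodic step base 4 = base 4F
periodic step base 5 = base 5F
periodic step base 6 = base 6F
periodic step base 7 = base 7F
periodic step base (suc (suc (suc (suc (suc (suc (suc (suc j)))))))) = step j (periodic step base j)

offsets>0 : ∀ j → All (0 <_) (offsets j)
offsets>0 = periodic (λ _ r → r) (from-yes (Finₚ.all? {8} λ p → All.all? (0 <?_) (offsets (toℕ p))))

offsets≤4 : ∀ j → length (offsets j) ≤ 4
offsets≤4 = periodic (λ _ r → r) (from-yes (Finₚ.all? {8} λ p → length (offsets (toℕ p)) ≤? 4))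

8∈offsets : ∀ j → 8 ∈ offsets j
8∈offsets = periodic (λ _ r → r) (from-yes (Finₚ.all? {8} λ p → 8 ∈? offsets (toℕ p)))

offsets-layer : ∀ i p → offsets (i * 8 + p) ≡ offsets p
offsets-layer zero    p = refl
offsets-layer (suc i) p = offsets-layer i p

-- Written with addition, so that in the bottom layer the distance 8 leads to no vertex.
Earlier : ℕ → ℕ → Set
Earlier u v = ∃ λ d → d ∈ offsets v × u + d ≡ v

-- A colouring order for a window, last vertex first.
Arrangement : ℕ → List ℕ → Set
Arrangement n ps = Unique ps × All (_∈ ps) (upTo n)

arrangement? : ∀ n ps → Dec (Arrangement n ps)
arrangement? n ps = unique? ps ×-dec All.all? (_∈? ps) (upTo n)

-- Extending a partial colouring by one window

module _ {k : ℕ} (list : ℕ → Fin k → ℕ) (list-inj : ∀ j → Injective _≡_ _≡_ (list j)) where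

  -- The certificate on an initial segment of the indices, with the index itself as rank.
  record Partial (M b : ℕ) : Set where
    field
      colour group : ℕ → ℕ
      valid  : ∀ {j} → j < M → ∃ λ s → list j s ≡ colour j
      bound  : ∀ {j} → j < M → group j < b
      sep    : ∀ {i j} → i < M → j < M → colour i ≡ colour j → group i ≡ group j → i ≡ j
      forest : ∀ {u v w} → v < M → Earlier u v → Earlier w v → colour u ≡ colour v → colour w ≡ colour v → u ≡ w

  -- What `F` must achieve, rather than a list of neighbour colours: it may be empty where the
  -- neighbours are known to differ, and may hold further colours to avoid.
  Adequate : (c : ℕ → ℕ) (m v : ℕ) → List ℕ → Set
  Adequate c m v F = ∀ {a u w} → count a F ≤ 1 → u < m → w < m → Earlier u v → Earlier w v →
    c u ≡ a → c w ≡ a → u ≡ w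

  nearer : ∀ {u v} → Earlier u v → u < v
  nearer {u} {v} (d , d∈ , refl) = m<m+n u (All.lookup (offsets>0 v) d∈)

  record Step {m b} (S : Partial m b) (n : ℕ) (F : ℕ → List ℕ) : Set where
    field
      result : Partial (m + n) (suc b)
      old    : ∀ {j} → j < m → Partial.colour result j ≡ Partial.colour S j
      rare   : ∀ {p} → p < n → count (Partial.colour result (m + p)) (F p) ≤ 1

  -- The window forms the new group `b`. Being rainbow, it has no monochromatic edge inside, so
  -- earlier neighbours of equal colour lie before `m`, where rarity and adequacy leave at most one.
  colourWindow : ∀ {m b} (S : Partial m b) {n} F {ps} → Arrangement n ps → Weighted list list-inj m F ps →
    (∀ {p} → p < n → Adequate (Partial.colour S) m (m + p) (F p)) → Step S n F
  colourWindow {m} {b} S {n} F {ps} (ps! , covers) weights adequate = record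
    { result = record
        { colour = colour
        ; group  = group
        ; valid  = valid
        ; bound  = bound
        ; sep    = sep
        ; forest = forest
        }
    ; old  = unchanged
    ; rare = E.rare ∘ position∈
    }
    where
    module S = Partial S
    module E = Extension (extendColouring list list-inj m F ps! weights S.colour)

    colour : ℕ → ℕ
    colour = E.colour

    position∈ : ∀ {p} → p < n → p ∈ ps
    position∈ p<n = All.lookup covers (∈-upTo⁺ p<n)

    unchanged : ∀ {j} → j < m → colour j ≡ S.colour j
    unchanged {j} j<m = E.old j λ {p} _ j≡ → <⇒≱ j<m (subst (m ≤_) (sym j≡) (m≤m+n m p))

    data Position : ℕ → Set where
      before : ∀ {j} → j < m → Position j
      inside : ∀ p → p < n → Position (m + p)

    locate : ∀ {j} → j < m + n → Position j
    locate {j} j< with j <? m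
    ... | yes j<m = before j<m
    ... | no  j≮m = subst Position (m+[n∸m]≡n m≤j)
      (inside (j ∸ m) (+-cancelˡ-< m _ _ (subst (_< m + n) (sym (m+[n∸m]≡n m≤j)) j<)))
      where m≤j = ≮⇒≥ j≮m

    group : ℕ → ℕ
    group j with j <? m
    ... | yes _ = S.group j
    ... | no _  = b

    group-before : ∀ {j} → j < m → group j ≡ S.group j
    group-before {j} j<m with j <? m
    ... | yes _   = refl
    ... | no  j≮m = contradiction j<m j≮m

    group-inside : ∀ p → group (m + p) ≡ b
    group-inside p with m + p <? m
    ... | yes lt = contradiction lt (m+n≮m m p)
    ... | no _   = refl

    valid : ∀ {j} → j < m + n → ∃ λ s → list j s ≡ colour j
    valid j< with locate j<
    ... | before j<m   = proj₁ (S.valid j<m) , trans (proj₂ (S.valid j<m)) (sym (unchanged j<m))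
    ... | inside p p<n = E.valid (position∈ p<n)

    bound : ∀ {j} → j < m + n → group j < suc b
    bound j< with locate j<
    ... | before j<m   = subst (_< suc b) (sym (group-before j<m)) (m<n⇒m<1+n (S.bound j<m))
    ... | inside p p<n = subst (_< suc b) (sym (group-inside p)) (n<1+n b)

    sep : ∀ {i j} → i < m + n → j < m + n → colour i ≡ colour j → group i ≡ group j → i ≡ j
    sep i< j< same together with locate i< | locate j<
    ... | before i<m | before j<m = S.sep i<m j<m
      (trans (sym (unchanged i<m)) (trans same (unchanged j<m)))
      (trans (sym (group-before i<m)) (trans together (group-before j<m)))
    ... | before i<m | inside q _ = contradiction
      (trans (sym (group-before i<m)) (trans together (group-inside q))) (<⇒≢ (S.bound i<m))
    ... | inside p _ | before j<m = contradiction
      (trans (sym (group-before j<m)) (trans (sym together) (group-inside p))) (<⇒≢ (S.bound j<m))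
    ... | inside p p<n | inside q q<n = cong (m +_) (E.rainbow (position∈ p<n) (position∈ q<n) same)

    forest : ∀ {u v w} → v < m + n → Earlier u v → Earlier w v → colour u ≡ colour v → colour w ≡ colour v → u ≡ w
    forest {u} {v} {w} v< eu ew cu cw with locate v<
    ... | before v<m = S.forest v<m eu ew (back eu cu) (back ew cw)
      where
      back : ∀ {x} → Earlier x v → colour x ≡ colour v → S.colour x ≡ S.colour v
      back ex cx = trans (sym (unchanged (<-trans (nearer ex) v<m))) (trans cx (unchanged v<m))
    ... | inside p p<n = adequate p<n (E.rare (position∈ p<n)) (earlier<m eu cu) (earlier<m ew cw) eu ew
        (trans (sym (unchanged (earlier<m eu cu))) cu) (trans (sym (unchanged (earlier<m ew cw))) cw)
      where
      earlier<m : ∀ {x} → Earlier x (m + p) → colour x ≡ colour (m + p) → x < m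
      earlier<m ex cx with locate (<-trans (nearer ex) (+-monoʳ-< m p<n))
      ... | before x<m   = x<m
      ... | inside q q<n = contradiction (cong (m +_) (E.rainbow (position∈ q<n) (position∈ p<n) cx)) (<⇒≢ (nearer ex))

-- From position `x` of a window, exactly the distances above `x` lead out of it.
outer : ℕ → ℕ → List ℕ
outer x v = filter (x <?_) (offsets v)

-- `x` is coloured last and `y` second to last; 1 and 3 are the largest `f` with `2 l + f < 2 k` for
-- `l = k - 1` and `l = k - 2`.
Quad : ℕ → Set
Quad m = ∃₂ λ x y → ∃₂ λ z w → Arrangement 4 (x ∷ y ∷ z ∷ w ∷ []) ×
  length (outer x (m + x)) ≤ 1 × length (outer y (m + y)) ≤ 3

quad : ∀ m → Quad m
quad = periodic (λ _ r → r) base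
  where
  quad? : ∀ m x y z w → Dec (Arrangement 4 (x ∷ y ∷ z ∷ w ∷ []) ×
    length (outer x (m + x)) ≤ 1 × length (outer y (m + y)) ≤ 3)
  quad? m x y z w = arrangement? 4 (x ∷ y ∷ z ∷ w ∷ []) ×-dec
    (length (outer x (m + x)) ≤? 1) ×-dec (length (outer y (m + y)) ≤? 3)

  base : ∀ (p : Fin 8) → Quad (toℕ p)
  base 0F = 0 , 1 , 2 , 3 , from-yes (quad? 0 0 1 2 3)
  base 1F = 0 , 2 , 1 , 3 , from-yes (quad? 1 0 2 1 3)
  base 2F = 1 , 3 , 0 , 2 , from-yes (quad? 2 1 3 0 2)
  base 3F = 3 , 0 , 2 , 1 , from-yes (quad? 3 3 0 2 1)
  base 4F = 2 , 0 , 1 , 3 , from-yes (quad? 4 2 0 1 3)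
  base 5F = 3 , 1 , 0 , 2 , from-yes (quad? 5 3 1 0 2)
  base 6F = 2 , 3 , 0 , 1 , from-yes (quad? 6 2 3 0 1)
  base 7F = 1 , 2 , 3 , 0 , from-yes (quad? 7 1 2 3 0)

-- Windows of three vertices: x is coloured last and y second to last. DoubleAt treats two consecutive
-- windows at m and m + 3.
SingleAt : (m x y z : ℕ) → Set
SingleAt m x y z = Arrangement 3 (x ∷ y ∷ z ∷ []) × length (outer x (m + x)) ≤ 1 × length (outer y (m + y)) ≤ 3

DoubleAt : (m x y : ℕ) → Set
DoubleAt m x y =
  length (outer 1 (m + 1)) ≤ 1 × length (outer 0 (m + 0)) ≤ 3 × length (outer 2 (m + 2)) ≤ 3 ×
  x < 5 × Arrangement 3 (x ∷ y ∷ 2 ∷ []) ×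
  length (outer y (m + 3 + y)) ≤ 3 × All (λ d → d ≡ suc x ⊎ d ≡ 8) (outer x (m + 3 + x))

Single Double : ℕ → Set
Single m = ∃₂ λ x y → ∃ λ z → SingleAt m x y z
Double m = ∃₂ λ x y → DoubleAt m x y

-- Starts congruent to 3 and 5 modulo 8 are handled together with the preceding window, which starts
-- at residue 0 or 2.
triple : ∀ m → Single m ⊎ ∃ λ l → m ≡ l + 3 × Double l
triple = periodic
  (λ { _ (inj₁ s) → inj₁ s ; _ (inj₂ (l , m≡ , d)) → inj₂ (8 + l , cong (8 +_) m≡ , d) }) base
  where
  single? : ∀ m x y z → Dec (SingleAt m x y z)
  single? m x y z = arrangement? 3 (x ∷ y ∷ z ∷ []) ×-dec
    (length (outer x (m + x)) ≤? 1) ×-dec (length (outer y (m + y)) ≤? 3)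

  double? : ∀ m x y → Dec (DoubleAt m x y)
  double? m x y =
    (length (outer 1 (m + 1)) ≤? 1) ×-dec (length (outer 0 (m + 0)) ≤? 3) ×-dec (length (outer 2 (m + 2)) ≤? 3) ×-dec
    (x <? 5) ×-dec arrangement? 3 (x ∷ y ∷ 2 ∷ []) ×-dec
    (length (outer y (m + 3 + y)) ≤? 3) ×-dec All.all? (λ d → (d ≟ suc x) ⊎-dec (d ≟ 8)) (outer x (m + 3 + x))

  base : ∀ (p : Fin 8) → Single (toℕ p) ⊎ ∃ λ l → toℕ p ≡ l + 3 × Double l
  base 0F = inj₁ (0 , 1 , 2 , from-yes (single? 0 0 1 2))
  base 1F = inj₁ (0 , 2 , 1 , from-yes (single? 1 0 2 1))
  base 2F = inj₁ (1 , 0 , 2 , from-yes (single? 2 1 0 2))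
  base 3F = inj₂ (0 , refl , 0 , 1 , from-yes (double? 0 0 1))
  base 4F = inj₁ (2 , 0 , 1 , from-yes (single? 4 2 0 1))
  base 5F = inj₂ (2 , refl , 1 , 0 , from-yes (double? 2 1 0))
  base 6F = inj₁ (2 , 0 , 1 , from-yes (single? 6 2 0 1))
  base 7F = inj₁ (1 , 2 , 0 , from-yes (single? 7 1 2 0))

downFrom-arrangement : ∀ n → Arrangement n (downFrom n)
downFrom-arrangement n = Unique.downFrom⁺ n , All.tabulate (∈-downFrom⁺ ∘ ∈-upTo⁻)

-- The first `t` positions stand at the end of the list and hence are coloured first.
shift-arrangement : ∀ {n ps} t → Arrangement n ps → Arrangement (n + t) (map (t +_) ps ++ downFrom t)
shift-arrangement {n} {ps} t (ps! , covers) =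
  Unique.++⁺ (Unique.map⁺ (+-cancelˡ-≡ t _ _) ps!) (Unique.downFrom⁺ t) disjoint , All.tabulate (cover ∘ ∈-upTo⁻)
  where
  disjoint : ∀ {v} → ¬ (v ∈ map (t +_) ps × v ∈ downFrom t)
  disjoint (v∈ , v∈′) with ∈-map⁻ (t +_) v∈
  ... | p , _ , refl = m+n≮m t p (∈-downFrom⁻ v∈′)

  cover : ∀ {j} → j < n + t → j ∈ map (t +_) ps ++ downFrom t
  cover {j} j< with j <? t
  ... | yes j<t = ∈-++⁺ʳ (map (t +_) ps) (∈-downFrom⁺ j<t)
  ... | no  j≮t = ∈-++⁺ˡ (subst (_∈ map (t +_) ps) (m+[n∸m]≡n (≮⇒≥ j≮t))
      (∈-map⁺ (t +_) (All.lookup covers (∈-upTo⁺ (+-cancelˡ-< t _ _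
        (subst₂ _<_ (sym (m+[n∸m]≡n (≮⇒≥ j≮t))) (+-comm n t) j<))))))

-- A full window costs exactly one group.
ceil-step : ∀ m k .{{_ : NonZero k}} → suc ⌈ m / k ⌉ ≡ ⌈ m + k / k ⌉
ceil-step m k@(suc j) = sym (begin
  (m + k + j) / k       ≡⟨ cong (_/ k) (trans (cong (_+ j) (+-comm m k)) (+-assoc k m j)) ⟩
  (k + (m + j)) / k     ≡⟨ +-distrib-/-∣ˡ (m + j) ∣-refl ⟩
  k / k + (m + j) / k   ≡⟨ cong (_+ (m + j) / k) (n/n≡1 k) ⟩
  suc ((m + j) / k)     ∎)
  where open ≡-Reasoning

ceil-positive : ∀ m k .{{_ : NonZero k}} .{{_ : NonZero m}} → 1 ≤ ⌈ m / k ⌉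
ceil-positive (suc m) k@(suc j) = subst (_≤ (suc m + j) / k) (n/n≡1 k) (/-monoˡ-≤ k (s≤s (m≤n+m j m)))

-- Weights and adequate lists

module _ {k : ℕ} (list : ℕ → Fin k → ℕ) (list-inj : ∀ j → Injective _≡_ _≡_ (list j)) where

  private
    PartialSolution = Partial list list-inj

  weaken : ∀ {M b b′} → b ≤ b′ → PartialSolution M b → PartialSolution M b′
  weaken b≤ S = record
    { colour = colour ; group = group ; valid = valid ; sep = sep ; forest = forest
    ; bound = λ j< → <-≤-trans (bound j<) b≤ }
    where open Partial S

  empty : ∀ {b} → PartialSolution 0 b
  empty = record
    { colour = λ _ → 0 ; group = λ _ → 0
    ; valid = λ () ; bound = λ () ; sep = λ () ; forest = λ () }

  -- `s` counts colours left after `l` are used; `s = 1, 2, 3` allow `f` up to 1, 3, 5.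
  weight : ∀ s {l f} → f < s + s → l + s ≤ k → l + l + f < k + k
  weight s {l} {f} f< l≤ = begin-strict
    l + l + f          <⟨ +-monoʳ-< (l + l) f< ⟩
    l + l + (s + s)    ≡⟨ interchange l l s s ⟩
    l + s + (l + s)    ≤⟨ +-mono-≤ l≤ l≤ ⟩
    k + k              ∎
    where open ≤-Reasoning

  module _ {m : ℕ} {F : ℕ → List ℕ} where
    -- The bound 5 leaves room for the two extra entries that the three-colour case adds to a list
    -- of three.
    weighted-others : ∀ {ps} → 2 + length ps ≤ k → All (λ p → length (F p) ≤ 5) ps → Weighted list list-inj m F ps
    weighted-others _ [] = []
    weighted-others {_ ∷ ps} l≤ (f≤ ∷ fs≤) =
      weight 3 {length ps} (s≤s f≤) (subst (_≤ k) (+-comm 3 (length ps)) l≤) ∷ weighted-others (≤-trans (n≤1+n _) l≤) fs≤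

    weighted : ∀ {p q ps} → 2 + length ps ≤ k → length (F p) ≤ 1 → length (F q) ≤ 3 →
      All (λ r → length (F r) ≤ 5) ps → Weighted list list-inj m F (p ∷ q ∷ ps)
    weighted {ps = ps} l≤ p≤ q≤ r≤ =
      weight 1 {suc (length ps)} (s≤s p≤) (subst (_≤ k) (+-comm 1 (suc (length ps))) l≤)
      ∷ weight 2 {length ps} (s≤s q≤) (subst (_≤ k) (+-comm 2 (length ps)) l≤)
      ∷ weighted-others l≤ r≤

    weighted-free : ∀ {ps} → length ps ≤ k → (∀ p → F p ≡ []) → Weighted list list-inj m F ps
    weighted-free {[]} _ _ = []
    weighted-free {p ∷ ps} l≤ free =
      weight 1 {length ps} (subst (λ f → length f < 2) (sym (free p)) z<s) (subst (_≤ k) (+-comm 1 (length ps)) l≤)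
      ∷ weighted-free (≤-trans (n≤1+n _) l≤) free

  -- Nothing precedes the first window, so empty lists are vacuously adequate.
  initial : ∀ {n} → n ≤ k → PartialSolution n 1
  initial {n} n≤k = Step.result (colourWindow list list-inj empty (λ _ → []) (downFrom-arrangement n)
    (weighted-free (subst (_≤ k) (sym (length-downFrom n)) n≤k) (λ _ → refl)) λ _ _ ())

  -- Where `d` exceeds `v`, truncated subtraction adds the colour of vertex 0, which only
  -- strengthens the restriction.
  outerColours : (c : ℕ → ℕ) (x v : ℕ) → List ℕ
  outerColours c x v = map (λ d → c (v ∸ d)) (outer x v)

  outerColours-length : ∀ c x v → length (outerColours c x v) ≡ length (outer x v)
  outerColours-length c x v = length-map (λ d → c (v ∸ d)) (outer x v)

  outerColours≤4 : ∀ c x v → length (outerColours c x v) ≤ 4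
  outerColours≤4 c x v = ≤-trans (≤-reflexive (outerColours-length c x v))
    (≤-trans (length-filter (x <?_) (offsets v)) (offsets≤4 v))

  module _ (c : ℕ → ℕ) (m : ℕ) where
    outer∈ : ∀ {x p u d} → x ≤ p → u < m → d ∈ offsets (m + p) → u + d ≡ m + p → d ∈ outer x (m + p)
    outer∈ {x} {p} {u} {d} x≤p u<m d∈ eq = ∈-filter⁺ (x <?_) d∈ (≤-<-trans x≤p
      (+-cancelˡ-< m _ _ (≤-<-trans (≤-reflexive (sym eq)) (+-monoˡ-< d u<m))))

    -- A neighbour before `m` is at distance above `p`, hence above `x`; two of them with colour `a`
    -- would give `a` two entries.
    outer-adequate : ∀ {x p} → x ≤ p → Adequate list list-inj c m (m + p) (outerColours c x (m + p))
    outer-adequate {x} {p} x≤p {a} {u} {w} rare u<m w<m (d , d∈ , ud) (e , e∈ , we) cu cw =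
      +-cancelʳ-≡ d u w (trans ud (trans (sym we) (cong (w +_) (sym d≡e))))
      where
      same : ∀ {y f} → y + f ≡ m + p → c y ≡ a → c (m + p ∸ f) ≡ a
      same {y} {f} eq cy = trans (cong c (trans (cong (_∸ f) (sym eq)) (m+n∸n≡m y f))) cy

      d≡e : d ≡ e
      d≡e = ∈-≤1 (subst (_≤ 1) (length-filter-map (_≟ a) (λ d → c (m + p ∸ d)) (outer x (m + p))) rare)
        (∈-filter⁺ (λ d → c (m + p ∸ d) ≟ a) (outer∈ x≤p u<m d∈ ud) (same ud cu))
        (∈-filter⁺ (λ d → c (m + p ∸ d) ≟ a) (outer∈ x≤p w<m e∈ we) (same we cw))

    adequate-++ : ∀ {v F} G → Adequate list list-inj c m v F → Adequate list list-inj c m v (G ++ F)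
    adequate-++ {F = F} G adequate {a} rare =
      adequate (≤-trans (m≤n+m _ (count a G)) (≤-trans (≤-reflexive (sym (count-++ a G F))) rare))

-- At least four colours

module _ {t : ℕ} (list : ℕ → Fin (4 + t) → ℕ) (list-inj : ∀ j → Injective _≡_ _≡_ (list j)) where
  private
    k : ℕ
    k = 4 + t

  colourQuad : ∀ {m b} → Partial list list-inj m b → Partial list list-inj (m + k) (suc b)
  colourQuad {m} S with quad (m + t)
  ... | x , y , z , w , arranged , x≤1 , y≤3 =
    Step.result (colourWindow list list-inj S F (shift-arrangement t arranged)
      (weighted list list-inj (≤-reflexive (cong (4 +_) (length-downFrom t)))
        (subst (_≤ 1) (sym (last-four x)) x≤1) (subst (_≤ 3) (sym (last-four y)) y≤3)
        (All.universal (λ p → m≤n⇒m≤1+n (outerColours≤4 list list-inj c (p ∸ t) (m + p))) _))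
      λ {p} _ → outer-adequate list list-inj c m (m∸n≤m p t))
    where
    c : ℕ → ℕ
    c = Partial.colour S

    F : ℕ → List ℕ
    -- Every distance reaching before the last four vertices is counted, even into the same window,
    -- so the counts are those of `quad (m + t)`.
    F p = outerColours list list-inj c (p ∸ t) (m + p)

    last-four : ∀ x → length (F (t + x)) ≡ length (outer x (m + t + x))
    last-four x = trans (outerColours-length list list-inj c (t + x ∸ t) (m + (t + x)))
      (cong₂ (λ y v → length (outer y v)) (m+n∸m≡n t x) (sym (+-assoc m t x)))

  partial≥4 : ∀ M → Partial list list-inj M ⌈ M / k ⌉
  partial≥4 = <-rec _ go
    where
    go : ∀ M → (∀ {m} → m < M → Partial list list-inj m ⌈ m / k ⌉) → Partial list list-inj M ⌈ M / k ⌉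
    go zero rec = empty list list-inj
    go M@(suc _) rec with M ≤? k
    ... | yes M≤k = weaken list list-inj (ceil-positive M k) (initial list list-inj M≤k)
    ... | no  M≰k = subst (λ M → Partial list list-inj M ⌈ M / k ⌉) (m∸n+n≡m (≰⇒≥ M≰k))
      (subst (Partial list list-inj (M ∸ k + k)) (ceil-step (M ∸ k) k) (colourQuad (rec (m∸n<m M k))))
      where
      m∸n<m : ∀ m n .{{_ : NonZero m}} .{{_ : NonZero n}} → m ∸ n < m
      m∸n<m (suc m) (suc n) = s≤s (m∸n≤m m n)

-- Three colours

module _ (list : ℕ → Fin 3 → ℕ) (list-inj : ∀ j → Injective _≡_ _≡_ (list j)) where

  colourSingle : ∀ {m b} → Single m → Partial list list-inj m b → Partial list list-inj (m + 3) (suc b)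
  colourSingle {m} (x , y , z , arranged , x≤1 , y≤3) S =
    Step.result (colourWindow list list-inj S F arranged
      (weighted list list-inj ≤-refl
        (≤-trans (≤-reflexive (outerColours-length list list-inj c x (m + x))) x≤1)
        (≤-trans (≤-reflexive (outerColours-length list list-inj c y (m + y))) y≤3)
        (m≤n⇒m≤1+n (outerColours≤4 list list-inj c z (m + z)) ∷ []))
      λ _ → outer-adequate list list-inj c m ≤-refl)
    where
    c : ℕ → ℕ
    c = Partial.colour S

    F : ℕ → List ℕ
    F p = outerColours list list-inj c p (m + p)

  -- The vertex v = m + 3 + x has two earlier neighbours outside its own window: m + 2, and v ∸ 8, which
  -- lies before m. The first window gives them different colours, so neither restricts the colour of v.
  colourDouble : ∀ {m b} → Double m → Partial list list-inj m b → Partial list list-inj (m + 3 + 3) (suc (suc b))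
  colourDouble {m} (x , y , one , zero₃ , two , x<5 , arranged , y≤3 , only) S =
    Step.result (colourWindow list list-inj S₁ F₂ arranged
      (weighted list list-inj ≤-refl at-x
        (≤-trans (F₂≤ y) (≤-trans (≤-reflexive (outerColours-length list list-inj c₁ y (m + 3 + y))) y≤3))
        (m≤n⇒m≤1+n (≤-trans (F₂≤ 2) (outerColours≤4 list list-inj c₁ 2 (m + 3 + 2))) ∷ []))
      λ {p} _ → F₂-adequate p)
    where
    c : ℕ → ℕ
    c = Partial.colour S

    far : ℕ
    far = m + 3 + x ∸ 8

    extra : ℕ → List ℕ
    -- Two copies make rarity forbid this colour at `m + 2`.
    extra 2 = c far ∷ c far ∷ []
    extra _ = []

    F₁ : ℕ → List ℕ
    F₁ p = extra p ++ outerColours list list-inj c p (m + p)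

    first : Step list list-inj S 3 F₁
    first = colourWindow list list-inj S F₁ {1 ∷ 0 ∷ 2 ∷ []} (from-yes (arrangement? 3 (1 ∷ 0 ∷ 2 ∷ [])))
      (weighted list list-inj ≤-refl
        (≤-trans (≤-reflexive (outerColours-length list list-inj c 1 (m + 1))) one)
        (≤-trans (≤-reflexive (outerColours-length list list-inj c 0 (m + 0))) zero₃)
        (+-monoʳ-≤ 2 (≤-trans (≤-reflexive (outerColours-length list list-inj c 2 (m + 2))) two) ∷ []))
      λ {p} _ → adequate-++ list list-inj c m (extra p) (outer-adequate list list-inj c m ≤-refl)

    S₁ : Partial list list-inj (m + 3) _
    S₁ = Step.result first

    c₁ : ℕ → ℕ
    c₁ = Partial.colour S₁

    F₂ : ℕ → List ℕ
    F₂ p with p ≟ x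
    ... | yes _ = []
    ... | no _  = outerColours list list-inj c₁ p (m + 3 + p)

    at-x : length (F₂ x) ≤ 1
    at-x with x ≟ x
    ... | yes _  = z≤n
    ... | no x≢x = contradiction refl x≢x

    F₂≤ : ∀ p → length (F₂ p) ≤ length (outerColours list list-inj c₁ p (m + 3 + p))
    F₂≤ p with p ≟ x
    ... | yes _ = z≤n
    ... | no _  = ≤-refl

    -- Otherwise the colour of `m + 2` would occur twice in `extra 2`; as `far` precedes `m`, the
    -- first window left its colour unchanged.
    differ : far < m → c₁ (m + 2) ≢ c₁ far
    differ far<m same = <⇒≱ (s≤s (s≤s z≤n)) (≤-trans
      (≤-trans (+-mono-≤ (∈⇒0<count far∈) (∈⇒0<count far∈)) (≤-reflexive (sym (count-++ (c₁ (m + 2)) (c far ∷ []) (c far ∷ [])))))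
      (≤-trans (m≤m+n _ _) (≤-trans (≤-reflexive (sym (count-++ (c₁ (m + 2)) (extra 2) _))) (Step.rare first {2} ≤-refl))))
      where
      far∈ : c₁ (m + 2) ∈ c far ∷ []
      far∈ = here (trans same (Step.old first far<m))

    F₂-adequate : ∀ p → Adequate list list-inj c₁ (m + 3) (m + 3 + p) (F₂ p)
    F₂-adequate p with p ≟ x
    ... | no _     = outer-adequate list list-inj c₁ (m + 3) ≤-refl
    ... | yes refl = λ _ u< w< (d , d∈ , ud) (e , e∈ , we) cu cw →
      coincide (All.lookup only (outer∈ list list-inj c₁ (m + 3) ≤-refl u< d∈ ud))
              (All.lookup only (outer∈ list list-inj c₁ (m + 3) ≤-refl w< e∈ we)) ud we (trans cu (sym cw))
      where
      near-u : ∀ {u} → u + suc p ≡ m + 3 + p → u ≡ m + 2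
      near-u {u} eq = +-cancelʳ-≡ (suc p) u (m + 2) (trans eq (trans (+-assoc m 3 p) (sym (+-assoc m 2 (suc p)))))

      far-u : ∀ {u} → u + 8 ≡ m + 3 + p → u ≡ far
      far-u {u} eq = trans (sym (m+n∸n≡m u 8)) (cong (_∸ 8) eq)

      -- By `x < 5`, eight steps back from `m + 3 + x` lead in front of the first window.
      far<m : far + 8 ≡ m + 3 + p → far < m
      far<m eq = +-cancelʳ-< 8 far m (begin-strict
        far + 8      ≡⟨ eq ⟩
        m + 3 + p    <⟨ +-monoʳ-< (m + 3) x<5 ⟩
        m + 3 + 5    ≡⟨ +-assoc m 3 5 ⟩
        m + 8        ∎)
        where open ≤-Reasoning

      coincide : ∀ {u w d e} → d ≡ suc p ⊎ d ≡ 8 → e ≡ suc p ⊎ e ≡ 8 →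
        u + d ≡ m + 3 + p → w + e ≡ m + 3 + p → c₁ u ≡ c₁ w → u ≡ w
      coincide (inj₁ refl) (inj₁ refl) ud we _ = +-cancelʳ-≡ _ _ _ (trans ud (sym we))
      coincide (inj₂ refl) (inj₂ refl) ud we _ = +-cancelʳ-≡ _ _ _ (trans ud (sym we))
      coincide (inj₁ refl) (inj₂ refl) ud we same with near-u ud | far-u we
      ... | refl | refl = contradiction same (differ (far<m we))
      coincide (inj₂ refl) (inj₁ refl) ud we same with far-u ud | near-u we
      ... | refl | refl = contradiction (sym same) (differ (far<m ud))

  partial₃ : ∀ M → Partial list list-inj M ⌈ M / 3 ⌉
  partial₃ = <-rec _ go
    where
    PartialUpTo : ℕ → Set
    PartialUpTo M = Partial list list-inj M ⌈ M / 3 ⌉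

    go : ∀ M → (∀ {m} → m < M → PartialUpTo m) → PartialUpTo M
    go zero rec = empty list list-inj
    go 1 rec = initial list list-inj (s≤s z≤n)
    go 2 rec = initial list list-inj (s≤s (s≤s z≤n))
    go (suc (suc (suc m))) rec with triple m
    ... | inj₁ s = subst PartialUpTo (+-comm m 3)
      (subst (Partial list list-inj (m + 3)) (ceil-step m 3) (colourSingle s (rec (m≤n+m (suc m) 2))))
    ... | inj₂ (l , refl , d) = subst PartialUpTo (+-comm (l + 3) 3)
      (subst (Partial list list-inj (l + 3 + 3)) (trans (cong suc (ceil-step l 3)) (ceil-step (l + 3) 3))
        (colourDouble d (rec (≤-trans (s≤s (m≤m+n l 3)) (m≤n+m (suc (l + 3)) 2)))))

-- From indices back to cells

index : Cell → ℕ
index (p , i) = i * 8 + toℕ p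

cellAt : ℕ → Cell
cellAt = periodic (λ { _ (p , i) → p , suc i }) (_, 0)

cellAt-index : ∀ x → cellAt (index x) ≡ x
cellAt-index (0F , zero) = refl
cellAt-index (1F , zero) = refl
cellAt-index (2F , zero) = refl
cellAt-index (3F , zero) = refl
cellAt-index (4F , zero) = refl
cellAt-index (5F , zero) = refl
cellAt-index (6F , zero) = refl
cellAt-index (7F , zero) = refl
cellAt-index (p , suc i) = cong (λ { (p , i) → p , suc i }) (cellAt-index (p , i))

index-injective : ∀ {x y} → index x ≡ index y → x ≡ y
index-injective {x} {y} eq = trans (sym (cellAt-index x)) (trans (cong cellAt eq) (cellAt-index y))

index< : ∀ {n} p {i} → i < n → index (p , i) < n * 8
index< p = quotient-< (Finₚ.toℕ<n p)

-- Ties the table `offsets` to the adjacency of the cube, by finite check.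
lowerNeighbours : ∀ p → All (λ q → toℕ q ≤ toℕ p → Any (λ d → toℕ q + d ≡ toℕ p) (offsets (toℕ p))) (neighbours p)
lowerNeighbours = from-yes (Finₚ.all? λ p → All.all? (λ q →
  (toℕ q ≤? toℕ p) →-dec Any.any? (λ d → toℕ q + d ≟ toℕ p) (offsets (toℕ p))) (neighbours p))

near⇒earlier : ∀ {x y} → Near x y → index y ≤ index x → Earlier (index y) (index x)
near⇒earlier {p , i} {q , i} (across q∈) q≤p
  with find (All.lookup (lowerNeighbours p) q∈ (+-cancelˡ-≤ (i * 8) _ _ q≤p))
... | d , d∈ , eq = d , subst (d ∈_) (sym (offsets-layer i (toℕ p))) d∈ ,
  trans (+-assoc (i * 8) (toℕ q) d) (cong (i * 8 +_) eq)
-- `up≤` reads `8 + n ≤ n`, that is, `7 + n < n`, for the index `n` of the lower cell.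
near⇒earlier {p , i} up up≤ = contradiction up≤ (m+n≮n 7 (i * 8 + toℕ p))
near⇒earlier {p , suc i} down _ = 8 , 8∈offsets (8 + (i * 8 + toℕ p)) , +-comm (i * 8 + toℕ p) 8

solution≥3 : ∀ {k} →
  (∀ list list-inj M → Partial {k} list list-inj M ⌈ M / k ⌉) →
  ∀ n (list : Cell → Fin k → ℕ) → (∀ x → Injective _≡_ _≡_ (list x)) → Solution n k list
solution≥3 partial n list list-inj = record
  { colour = S.colour ∘ index
  ; rank   = index
  ; group  = S.group ∘ index
  ; valid  = valid
  ; bound  = λ p i<n → S.bound (index< p i<n)
  ; sep    = λ {p} {q} i<n j<n same together → index-injective (S.sep (index< p i<n) (index< q j<n) same together)
  ; forest = λ {x} x< _ _ x~y x~z cy cz y≤x z≤x → index-injective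
      (S.forest (index< (proj₁ x) x<) (near⇒earlier x~y y≤x) (near⇒earlier x~z z≤x) cy cz)
  }
  where
  module S = Partial (partial (list ∘ cellAt) (list-inj ∘ cellAt) (n * 8))

  valid : ∀ p {i} → i < n → ∃ λ s → list (p , i) s ≡ S.colour (index (p , i))
  valid p {i} i<n with S.valid (index< p i<n)
  ... | s , eq = s , trans (cong (λ x → list x s) (sym (cellAt-index (p , i)))) eq

theorem10 : (n₄ k : ℕ) → 2 ≤ k →
    EquitablyListArborable (P 2 □ P 2 □ P 2 □ P n₄) k
theorem10 n 0 ()
theorem10 n 1 (s≤s ())
theorem10 n 2 _ = arborable n 2 λ list list-inj → solution₂ list list-inj n
theorem10 n 3 _ = arborable n 3 (solution≥3 partial₃ n)
theorem10 n k@(suc (suc (suc (suc _)))) _ = arborable n k (solution≥3 partial≥4 n)
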